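{- Let $G$ be a simple graph of order $n$. Then $G$ is connected if and only if $\deg_x\bigl(da(G;x,y)\bigr)=n$.
   Context: All graphs are finite, simple and have at least one vertex. For a graph $G$, $S\subseteq V(G)$ and $u\in V(G)$, let $\bar S=V(G)\setminus S$, let $\delta_S(u)=|\{v\in S:\{u,v\}\in E(G)\}|$, and let $G[S]$ be the subgraph induced by $S$. The defensive alliance polynomial of $G$ is $$da(G;x,y)=\sum_{S} x^{|S|}\,y^{f_y(S)},\qquad f_y(S)=\min_{u\in S}\bigl(\delta_S(u)-\delta_{\bar S}(u)+|V(G)|\bigr),$$ where the sum runs over all non-empty $S\subseteq V(G)$ such that $G[S]$ is connected (single-vertex graphs are connected). $\deg_x$ denotes the degree in the variable $x$. -}

module Defs where

open import Data.Fin using (Fin)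
open import Data.Fin.Subset using (Subset; inside; outside; _∈_; Nonempty; ∣_∣; _∩_; ∁)
open import Data.Fin.Subset.Properties using (_∈?_; nonempty?)
import Data.Fin as Fin
open import Data.Integer as ℤ using (ℤ; 0ℤ; 1ℤ)
open import Data.List using (List; []; _∷_; _++_; map; filter; foldr; allFin)
import Data.List.Extrema
open import Data.List.Membership.Propositional using () renaming (_∈_ to _∈ˡ_)
open import Data.List.Membership.Propositional.Properties using (∈-allFin)
open import Data.List.Relation.Unary.All as All using (all?)
open import Data.List.Relation.Unary.Any using (here; there)
open import Data.Nat as ℕ using (ℕ; zero; suc; _+_; _∸_)
open import Data.Nat.Properties using (≤-totalOrder)
open import Data.Product using (∃; _×_; _,_; proj₁)
open import Data.Sum using (_⊎_; inj₁; inj₂)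
open import Data.Vec as Vec using (tabulate)
open import Data.Vec.Properties.WithK using ([]=-irrelevant)
open import Level using (0ℓ)
open import Relation.Binary using (Rel; Decidable; DecidableEquality; Symmetric; Irreflexive)
open import Relation.Binary.Construct.Closure.ReflexiveTransitive using (Star; ε; _◅_; _◅◅_)
open import Relation.Binary.PropositionalEquality using (_≡_; refl; cong)
open import Relation.Nullary using (Dec; yes; no; does; ¬?; contradiction)
open import Relation.Nullary.Decidable using (_×-dec_; _⊎-dec_; map′)

open Data.List.Extrema ≤-totalOrder using (min; max)

-- A simple graph of order n is a SimpleGraph (Fin n).  Adjacency is decidable,
-- so that edges can be counted.
record SimpleGraph (V : Set) : Set₁ where
  field
    _~_      : Rel V 0ℓ
    _~?_     : Decidable _~_
    ~-sym    : Symmetric _~_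
    ~-irrefl : Irreflexive _≡_ _~_

-- Vacuously true when V is empty; only nonempty V are of interest.
Connected : ∀ {V} → SimpleGraph V → Set
Connected G = ∀ u v → Star _~_ u v
  where open SimpleGraph G

induced : ∀ {n} → SimpleGraph (Fin n) → (S : Subset n) → SimpleGraph (∃ (_∈ S))
induced G S = record
  { _~_      = λ u v → proj₁ u ~ proj₁ v
  ; _~?_     = λ u v → proj₁ u ~? proj₁ v
  ; ~-sym    = ~-sym
  ; ~-irrefl = λ { refl → ~-irrefl refl }
  }
  where open SimpleGraph G

module Warshall {V : Set} (_≟_ : DecidableEquality V) (G : SimpleGraph V) where
  open SimpleGraph G

  -- Reach ws u v: there is a walk from u to v whose inner vertices lie in ws.
  Reach : List V → V → V → Set
  Reach []       u v = u ≡ v ⊎ u ~ v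
  Reach (w ∷ ws) u v = Reach ws u v ⊎ (Reach ws u w × Reach ws w v)

  reach? : ∀ ws u v → Dec (Reach ws u v)
  reach? []       u v = (u ≟ v) ⊎-dec (u ~? v)
  reach? (w ∷ ws) u v = reach? ws u v ⊎-dec (reach? ws u w ×-dec reach? ws w v)

  sound : ∀ ws {u v} → Reach ws u v → Star _~_ u v
  sound []       (inj₁ refl)    = ε
  sound []       (inj₂ e)       = e ◅ ε
  sound (w ∷ ws) (inj₁ p)       = sound ws p
  sound (w ∷ ws) (inj₂ (p , q)) = sound ws p ◅◅ sound ws q

  base : ∀ ws {u v} → u ≡ v ⊎ u ~ v → Reach ws u v
  base []       p = p
  base (w ∷ ws) p = inj₁ (base ws p)

  join : ∀ ws {u m v} → m ∈ˡ ws → Reach ws u m → Reach ws m v → Reach ws u v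
  join (w ∷ ws) (here refl) p q = inj₂ (to p , from q)
    where
    to : ∀ {u} → Reach (w ∷ ws) u w → Reach ws u w
    to (inj₁ p)       = p
    to (inj₂ (p , _)) = p
    from : ∀ {v} → Reach (w ∷ ws) w v → Reach ws w v
    from (inj₁ q)       = q
    from (inj₂ (_ , q)) = q
  join (w ∷ ws) (there m∈) (inj₁ p)       (inj₁ q)       = inj₁ (join ws m∈ p q)
  join (w ∷ ws) (there m∈) (inj₁ p)       (inj₂ (q , r)) = inj₂ (join ws m∈ p q , r)
  join (w ∷ ws) (there m∈) (inj₂ (p , q)) (inj₁ r)       = inj₂ (p , join ws m∈ q r)
  join (w ∷ ws) (there m∈) (inj₂ (p , _)) (inj₂ (_ , r)) = inj₂ (p , r)

  module _ (vs : List V) (complete : ∀ v → v ∈ˡ vs) where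

    reachable : ∀ {u v} → Star _~_ u v → Reach vs u v
    reachable ε        = base vs (inj₁ refl)
    reachable (e ◅ es) = join vs (complete _) (base vs (inj₂ e)) (reachable es)

    connected? : Dec (Connected G)
    connected? = map′
      (λ ps u v → All.lookup (All.lookup ps (complete u)) (complete v))
      (λ c → All.tabulate λ {u} _ → All.tabulate λ {v} _ → c u v)
      (all? (λ u → all? (λ v → map′ (sound vs) reachable (reach? vs u v)) vs) vs)

module _ {n : ℕ} (S : Subset n) where

  restrict : List (Fin n) → List (∃ (_∈ S))
  restrict []       = []
  restrict (v ∷ vs) with v ∈? S
  ... | yes v∈S = (v , v∈S) ∷ restrict vs
  ... | no  _   = restrict vs

  members : List (∃ (_∈ S))
  members = restrict (allFin n)

  ∈-restrict : ∀ vs (u : ∃ (_∈ S)) → proj₁ u ∈ˡ vs → u ∈ˡ restrict vs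
  ∈-restrict (v ∷ vs) (u , u∈S) p with v ∈? S
  ∈-restrict (v ∷ vs) (u , u∈S) (here refl) | yes u∈S′ = here (cong (u ,_) ([]=-irrelevant u∈S u∈S′))
  ∈-restrict (v ∷ vs) (u , u∈S) (there p)   | yes _    = there (∈-restrict vs _ p)
  ∈-restrict (v ∷ vs) (u , u∈S) (here refl) | no  u∉S  = contradiction u∈S u∉S
  ∈-restrict (v ∷ vs) (u , u∈S) (there p)   | no  _    = ∈-restrict vs _ p

  ∈-members : ∀ u → u ∈ˡ members
  ∈-members u = ∈-restrict (allFin n) u (∈-allFin (proj₁ u))

  _≟ᵐ_ : DecidableEquality (∃ (_∈ S))
  (u , u∈S) ≟ᵐ (v , v∈S) with u Fin.≟ v
  ... | yes refl = yes (cong (u ,_) ([]=-irrelevant u∈S v∈S))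
  ... | no  u≢v  = no λ { refl → u≢v refl }

inducedConnected? : ∀ {n} (G : SimpleGraph (Fin n)) (S : Subset n) → Dec (Connected (induced G S))
inducedConnected? G S =
  Warshall.connected? (_≟ᵐ_ S) (induced G S) (members S) (∈-members S)

-- term c i j denotes c xⁱ yʲ.
record Term : Set where
  constructor term
  field
    coefficient : ℤ
    xExp yExp   : ℕ
open Term

-- A list stands for the sum of its terms, with repetitions and zero
-- coefficients allowed; two lists denote the same polynomial when all their
-- coeff's agree.
Poly : Set
Poly = List Term

0ᵖ : Poly
0ᵖ = []

_+ᵖ_ : Poly → Poly → Poly
_+ᵖ_ = _++_

sumᵖ : List Poly → Poly
sumᵖ = foldr _+ᵖ_ 0ᵖ

x^_y^_ : ℕ → ℕ → Poly
x^ i y^ j = term 1ℤ i j ∷ []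

coeff : Poly → ℕ → ℕ → ℤ
coeff p i j =
  foldr ℤ._+_ 0ℤ (map coefficient (filter (λ t → (xExp t ℕ.≟ i) ×-dec (yExp t ℕ.≟ j)) p))

-- The largest i such that coeff p i j ≢ 0ℤ for some j.  (Such i , j occur as
-- exponents of a term in the list.)  The zero polynomial gets degree 0.
degₓ : Poly → ℕ
degₓ p = max 0 (map xExp (filter (λ t → ¬? (coeff p (xExp t) (yExp t) ℤ.≟ 0ℤ)) p))

subsets : ∀ n → List (Subset n)
subsets zero    = Vec.[] ∷ []
subsets (suc n) = map (outside Vec.∷_) (subsets n) ++ map (inside Vec.∷_) (subsets n)

module _ {n : ℕ} (G : SimpleGraph (Fin n)) where
  open SimpleGraph G

  neighbours : Fin n → Subset n
  neighbours u = tabulate λ v → does (u ~? v)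

  δ : Subset n → Fin n → ℕ
  δ S u = ∣ S ∩ neighbours u ∣

  -- Truncated subtraction is exact here, since δ (∁ S) u ≤ n.
  score : Subset n → Fin n → ℕ
  score S u = (δ S u + n) ∸ δ (∁ S) u

  -- The witness of nonemptiness only seeds the minimum; it is itself in S.
  f-y : (S : Subset n) → Nonempty S → ℕ
  f-y S (u₀ , _) = min (score S u₀) (map (λ u → score S (proj₁ u)) (members S))

  summand : Subset n → Poly
  summand S with nonempty? S ×-dec inducedConnected? G S
  ... | yes (S≢∅ , _) = x^ ∣ S ∣ y^ f-y S S≢∅
  ... | no  _         = 0ᵖ

  da : Poly
  da = sumᵖ (map summand (subsets n))

{-# OPTIONS --safe #-}
-- Every term of da has coefficient 1, so no cancellation occurs and degₓ (da G)
-- is the largest ∣ S ∣ over nonempty S inducing a connected subgraph.  It equals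
-- n exactly when S = ⊤ is such a set.
module Submission where

open import Data.Fin using (Fin; fromℕ<)
open import Data.Fin.Subset using (Subset; Nonempty; inside; outside; ∣_∣; ⊤)
open import Data.Fin.Subset.Properties using (∈⊤; nonempty?; ∣p∣≤n; ∣⊤∣≡n; ∣p∣≡n⇒p≡⊤)
open import Data.Integer as ℤ using (0ℤ; 1ℤ)
import Data.Integer.Properties as ℤ
open import Data.List using (List; []; _∷_; foldr; map; filter)
import Data.List.Extrema
open import Data.List.Membership.Propositional using (_∈_)
open import Data.List.Membership.Propositional.Properties
  using (∈-map⁺; ∈-map⁻; ∈-filter⁺; ∈-filter⁻; ∈-++⁺ˡ; ∈-++⁺ʳ; ∈-concat⁺′; ∈-concat⁻′)
open import Data.List.Relation.Unary.All as All using (All; []; _∷_)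
open import Data.List.Relation.Unary.Any using (here; there)
open import Data.Nat as ℕ using (ℕ; NonZero; ≢-nonZero⁻¹; >-nonZero⁻¹)
open import Data.Nat.Properties using (≤-antisym; ≤-totalOrder)
open import Data.Product using (∃-syntax; _×_; _,_; proj₁)
open import Data.Sum using (inj₁; inj₂)
import Data.Vec as Vec
open import Data.Vec.Properties.WithK using ([]=-irrelevant)
open import Function.Base using (_∘_)
open import Function.Bundles using (_⇔_; mk⇔)
open import Relation.Binary.Construct.Closure.ReflexiveTransitive using (gmap)
open import Relation.Binary.PropositionalEquality using (_≡_; _≢_; refl; sym; trans; subst)
open import Relation.Nullary using (Dec; yes; no; ¬?; contradiction)
open import Relation.Nullary.Decidable using (_×-dec_)
open import Defs

open Data.List.Extrema ≤-totalOrder using (max; xs≤max; max≤v⁺; argmax-sel)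
open Term

∈-subsets : ∀ {n} (S : Subset n) → S ∈ subsets n
∈-subsets Vec.[]            = here refl
∈-subsets (outside Vec.∷ S) = ∈-++⁺ˡ (∈-map⁺ (outside Vec.∷_) (∈-subsets S))
∈-subsets (inside  Vec.∷ S) = ∈-++⁺ʳ _ (∈-map⁺ (inside Vec.∷_) (∈-subsets S))

0≤coefficients : ∀ {p} → All (λ t → 0ℤ ℤ.< coefficient t) p →
                 0ℤ ℤ.≤ foldr ℤ._+_ 0ℤ (map coefficient p)
0≤coefficients []       = ℤ.≤-refl
0≤coefficients (c ∷ cs) = ℤ.+-mono-≤ (ℤ.<⇒≤ c) (0≤coefficients cs)

-- The membership `t ∈ p` excludes the empty sum, which is 0. One strict summand, found by following
-- it, makes the whole sum strict.
0<coefficients : ∀ {p t} → All (λ t → 0ℤ ℤ.< coefficient t) p → t ∈ p →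
                 0ℤ ℤ.< foldr ℤ._+_ 0ℤ (map coefficient p)
0<coefficients (c ∷ cs) (here _)  = ℤ.+-mono-<-≤ c (0≤coefficients cs)
0<coefficients (c ∷ cs) (there m) = ℤ.+-mono-≤-< (ℤ.<⇒≤ c) (0<coefficients cs m)

-- The filter inside `coeff` keeps `t` itself, and every other term it keeps is positive too, so
-- nothing can cancel.
coeff≢0 : ∀ {p t} → All (λ t → 0ℤ ℤ.< coefficient t) p → t ∈ p →
          coeff p (xExp t) (yExp t) ≢ 0ℤ
coeff≢0 {p} {t} cs t∈p =
  ℤ.<⇒≢ (0<coefficients (All.tabulate (All.lookup cs ∘ proj₁ ∘ ∈-filter⁻ matches?))
                        (∈-filter⁺ matches? t∈p (refl , refl)))
  ∘ sym
  where
  matches? : ∀ s → Dec (xExp s ≡ xExp t × yExp s ≡ yExp t)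
  matches? s = (xExp s ℕ.≟ xExp t) ×-dec (yExp s ℕ.≟ yExp t)

module _ (p : Poly) where

  nonvanishing? : ∀ t → Dec (coeff p (xExp t) (yExp t) ≢ 0ℤ)
  nonvanishing? t = ¬? (coeff p (xExp t) (yExp t) ℤ.≟ 0ℤ)

  -- Spelled as in `degₓ`, so that `degₓ p` is `max 0 xExps` by definition.
  xExps : List ℕ
  xExps = map xExp (filter nonvanishing? p)

  ∈-xExps⁻ : ∀ {i} → i ∈ xExps → ∃[ t ] t ∈ p × i ≡ xExp t
  ∈-xExps⁻ i∈ with ∈-map⁻ xExp i∈
  ... | t , t∈ , i≡ = t , proj₁ (∈-filter⁻ nonvanishing? t∈) , i≡

  degₓ-attained : degₓ p ≢ 0 → ∃[ t ] t ∈ p × degₓ p ≡ xExp t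
  -- `max` is `argmax` of the identity: its value is either the default 0 or an entry of the list.
  degₓ-attained d≢0 with argmax-sel (λ i → i) 0 xExps
  ... | inj₁ d≡0 = contradiction d≡0 d≢0
  ... | inj₂ d∈  = ∈-xExps⁻ d∈

  degₓ≤ : ∀ {n} → All (λ t → xExp t ℕ.≤ n) p → degₓ p ℕ.≤ n
  degₓ≤ {n} bounds = max≤v⁺ ℕ.z≤n (All.tabulate bounded)
    where
    bounded : ∀ {i} → i ∈ xExps → i ℕ.≤ n
    bounded i∈ with ∈-xExps⁻ i∈
    ... | _ , t∈p , refl = All.lookup bounds t∈p

  -- Positivity carries `t` through the filter for non-vanishing coefficients, so its exponent
  -- competes in the maximum.
  xExp≤degₓ : ∀ {t} → All (λ t → 0ℤ ℤ.< coefficient t) p → t ∈ p → xExp t ℕ.≤ degₓ p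
  xExp≤degₓ cs t∈p =
    All.lookup (xs≤max 0 xExps) (∈-map⁺ xExp (∈-filter⁺ nonvanishing? t∈p (coeff≢0 cs t∈p)))

module _ {n : ℕ} (G : SimpleGraph (Fin n)) where

  ∈-summand⁻ : ∀ S {t} → t ∈ summand G S →
               Connected (induced G S) × ∃[ j ] t ≡ term 1ℤ ∣ S ∣ j
  ∈-summand⁻ S t∈ with nonempty? S ×-dec inducedConnected? G S
  ∈-summand⁻ S (here t≡) | yes (_ , conn) = conn , _ , t≡
  ∈-summand⁻ S ()        | no _

  -- The exponent of `y` stays existential: `degₓ` concerns `x` only, and `summand` computes `f-y`
  -- from the witness that `nonempty?` returns, not from the given one.
  ∈-summand⁺ : ∀ S → Nonempty S → Connected (induced G S) →
               ∃[ j ] term 1ℤ ∣ S ∣ j ∈ summand G S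
  ∈-summand⁺ S S≢∅ conn with nonempty? S ×-dec inducedConnected? G S
  ... | yes _ = _ , here refl
  ... | no ¬c = contradiction (S≢∅ , conn) ¬c

  ∈-da⁻ : ∀ {t} → t ∈ da G →
          ∃[ S ] Connected (induced G S) × ∃[ j ] t ≡ term 1ℤ ∣ S ∣ j
  -- `sumᵖ` unfolds to the same fold as `concat`.
  ∈-da⁻ t∈ with ∈-concat⁻′ (map (summand G) (subsets n)) t∈
  ... | _ , t∈s , s∈ with ∈-map⁻ (summand G) s∈
  ... | S , _ , refl = S , ∈-summand⁻ S t∈s

  ∈-da⁺ : ∀ S → Nonempty S → Connected (induced G S) →
          ∃[ j ] term 1ℤ ∣ S ∣ j ∈ da G
  ∈-da⁺ S S≢∅ conn with ∈-summand⁺ S S≢∅ conn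
  ... | j , t∈ = j , ∈-concat⁺′ t∈ (∈-map⁺ (summand G) (∈-subsets S))

  da-positive : All (λ t → 0ℤ ℤ.< coefficient t) (da G)
  da-positive = All.tabulate positive
    where
    positive : ∀ {t} → t ∈ da G → 0ℤ ℤ.< coefficient t
    positive t∈ with ∈-da⁻ t∈
    ... | _ , _ , _ , refl = ℤ.+<+ (ℕ.s≤s ℕ.z≤n)

  da-xExp≤n : All (λ t → xExp t ℕ.≤ n) (da G)
  da-xExp≤n = All.tabulate bounded
    where
    bounded : ∀ {t} → t ∈ da G → xExp t ℕ.≤ n
    bounded t∈ with ∈-da⁻ t∈
    ... | S , _ , _ , refl = ∣p∣≤n S

  connected⇒induced-⊤ : Connected G → Connected (induced G ⊤)
  connected⇒induced-⊤ conn (u , u∈) (v , v∈)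
    -- Membership proofs are unique, so both endpoints may carry `∈⊤`; the walk then lifts vertex by
    -- vertex with its edges unchanged.
    rewrite []=-irrelevant u∈ ∈⊤ | []=-irrelevant v∈ ∈⊤ = gmap (_, ∈⊤) (λ e → e) (conn u v)

  induced-⊤⇒connected : Connected (induced G ⊤) → Connected G
  induced-⊤⇒connected conn u v = gmap proj₁ (λ e → e) (conn (u , ∈⊤) (v , ∈⊤))

  connected⇒degₓ≡n : .{{_ : NonZero n}} → Connected G → degₓ (da G) ≡ n
  connected⇒degₓ≡n conn
    -- Since `n` is non-zero, vertex 0 exists and witnesses that `⊤` is non-empty.
    with ∈-da⁺ ⊤ (fromℕ< (>-nonZero⁻¹ n) , ∈⊤) (connected⇒induced-⊤ conn)
  ... | _ , t∈ = ≤-antisym (degₓ≤ (da G) da-xExp≤n)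
    (subst (ℕ._≤ degₓ (da G)) (∣⊤∣≡n n) (xExp≤degₓ (da G) da-positive t∈))

  degₓ≡n⇒connected : .{{_ : NonZero n}} → degₓ (da G) ≡ n → Connected G
  degₓ≡n⇒connected d≡n
    -- As `n` is non-zero, the degree is not the default 0 and comes from an actual term.
    with degₓ-attained (da G) (λ d≡0 → ≢-nonZero⁻¹ n (trans (sym d≡n) d≡0))
  ... | t , t∈ , d≡t with ∈-da⁻ t∈
  ... | S , conn , _ , refl =
    induced-⊤⇒connected
      -- The set behind that term has `n` elements, hence is `⊤`.
      (subst (Connected ∘ induced G) (∣p∣≡n⇒p≡⊤ (trans (sym d≡t) d≡n)) conn)

proposition11 : (n : ℕ) .{{_ : NonZero n}} (G : SimpleGraph (Fin n)) → Connected G ⇔ (degₓ (da G) ≡ n)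
proposition11 n G = mk⇔ (connected⇒degₓ≡n G) (degₓ≡n⇒connected G)
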